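{- Let $n=\nu_{i_1}+\nu_{i_2}+\cdots+\nu_{i_k}$, where $k\ge 1$ and $i_1,\dots,i_k$ are positive integers. If $i_j-i_{j-1}\ge 3$ for every $j$ with $2\le j\le k$, then $\delta(n)=\delta_P(n)=k$.
   Context: $\nu_\ell=2^\ell-1$. $\mathcal{T}_\infty$ is the infinite binary tree with all leaves at the same level: its vertices are the pairs $(i,j)$ of integers with $i\ge 1$, $j\ge 0$; the vertex $(i,j)$ has parent $(i+1,\lfloor j/2\rfloor)$, and the edges join each vertex to its parent. For a finite vertex set $S$, $\overline S$ is its complement and $(S,\overline S)$ is the set of edges with one end in $S$ and the other in $\overline S$. $\delta(n)$ is the minimum of $|(S,\overline S)|$ over all $S\subset V(\mathcal{T}_\infty)$ with $|S|=n$; $\delta_P(n)$ is the minimum over those $S$ with $|S|=n$ for which $\overline S$ induces a connected subgraph. -}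

module Defs where

open import Data.List using (List; length)
open import Data.List.Membership.Propositional using () renaming (_∈_ to _∈ˡ_)
open import Data.List.Relation.Unary.Unique.Propositional using (Unique)
open import Data.Nat using (ℕ; suc; _∸_; _^_; _≤_; NonZero; ⌊_/2⌋)
open import Data.Product using (_×_; _,_; ∃-syntax)
open import Data.Sum using (_⊎_)
open import Function using (_⇔_)
open import Level using (Level; 0ℓ; _⊔_)
open import Relation.Binary using (Rel)
open import Relation.Binary.Construct.Closure.ReflexiveTransitive using (Star)
open import Relation.Binary.PropositionalEquality using (_≡_)
open import Relation.Unary using (Pred; _∈_; ∁)

ν : ℕ → ℕ
ν ℓ = 2 ^ ℓ ∸ 1

record V : Set where
  constructor vertex
  field
    level : ℕ
    index : ℕ
    .{{level-nonZero}} : NonZero level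

parent : V → V
parent (vertex i j) = vertex (suc i) ⌊ j /2⌋

Adj : Rel V 0ℓ
Adj u v = v ≡ parent u ⊎ u ≡ parent v

VertexSet : Set₁
VertexSet = Pred V 0ℓ

-- Finiteness is witnessed by a duplicate-free list of exactly the elements.
-- The list lies in the carrier rather than in Σ A P, so it is irrelevant how
-- many proofs of P x there are.
HasSize : {a p : Level} {A : Set a} → Pred A p → ℕ → Set (a ⊔ p)
HasSize {A = A} P m =
  ∃[ xs ] Unique xs × (∀ (x : A) → x ∈ˡ xs ⇔ x ∈ P) × length xs ≡ m

-- An undirected edge of (S, S̄) is represented by the ordered pair of its ends
-- with the end in S first, so each such edge occurs exactly once.
Cut : VertexSet → Pred (V × V) 0ℓ
Cut S (u , v) = u ∈ S × v ∈ ∁ S × Adj u v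

InducedAdj : VertexSet → Rel V 0ℓ
InducedAdj S u v = u ∈ S × v ∈ S × Adj u v

InducesConnected : VertexSet → Set
InducesConnected S = ∀ {u v} → u ∈ S → v ∈ S → Star (InducedAdj S) u v

IsMinimum : {p : Level} → Pred ℕ p → ℕ → Set p
IsMinimum P m = m ∈ P × (∀ m′ → m′ ∈ P → m ≤ m′)

CutSizes : ℕ → Pred ℕ (Level.suc 0ℓ)
CutSizes n m = ∃[ S ] HasSize S n × HasSize (Cut S) m

CutSizesP : ℕ → Pred ℕ (Level.suc 0ℓ)
CutSizesP n m =
  ∃[ S ] HasSize S n × InducesConnected (∁ S) × HasSize (Cut S) m

-- The minima are taken over infinitely many sets, so δ and δ_P are given by
-- their graphs: δ[ n ]≡ m says that the minimum is attained and equals m.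
δ[_]≡_ : ℕ → ℕ → Set₁
δ[ n ]≡ m = IsMinimum (CutSizes n) m

δP[_]≡_ : ℕ → ℕ → Set₁
δP[ n ]≡ m = IsMinimum (CutSizesP n) m

{-# OPTIONS --safe #-}
module Submission where

-- Let s a be the number of vertices of S on level a + 1 and p a the same number
-- for k disjoint full subtrees of heights i_1, …, i_k.  The edges between
-- levels a + 1 and a + 2 add at least |s a − 2 s (a + 1)| to the cut, while
-- p a − 2 p (a + 1) = c a is 1 if a + 1 is some i_j and 0 otherwise.  So with
-- D = s − p the lower bound says Σ |c a + D a − 2 D (a + 1)| ≥ Σ c a whenever
-- Σ D = 0.  A multiple of Σ D may be added to the left-hand side, and a potential
-- depending on D a then does the rest, level by level from the top down:
-- with multiplier 1 if D 0 ≥ 0, and with multiplier −1/3 if D 0 < 0.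
-- The latter only gives the inequality up to 2/3, which integrality absorbs, and
-- it is where the gaps are needed: passing a level with c a = 1 may cost 4/3,
-- and each of the two levels above it pays back 2/3.

open import Defs
open import Data.Nat using (ℕ; _+_; _≤_)
open import Data.Product using (_×_)
open import Data.Vec using (Vec; map; sum)
open import Data.Vec.Relation.Unary.All using (All)
open import Data.Vec.Relation.Unary.Linked using (Linked)
open import Relation.Binary.PropositionalEquality using (_≡_)

open import Data.List
  using (List; []; _∷_; _++_; length; filter; concatMap; upTo) renaming (map to mapˡ)
open import Data.Nat hiding (ℕ; _+_; _≤_)
open import Data.Nat.Properties
open import Data.Nat.Tactic.RingSolver using (solve; solve-∀)

-- Linear inequalities between consecutive levels

-- A Farkas certificate without subtraction: `P ≤ Q` is the weighted sum of the hypotheses and `k`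
-- the slack, so that only a semiring identity remains for the solver.
≤-certificate : ∀ {P Q L R} k → P ≤ Q → L + Q + k ≡ R + P → L ≤ R
≤-certificate {P} {Q} {L} {R} k P≤Q eq = +-cancelʳ-≤ Q L R (begin
  L + Q      ≤⟨ m≤m+n (L + Q) k ⟩
  L + Q + k  ≡⟨ eq ⟩
  R + P      ≤⟨ +-monoʳ-≤ R P≤Q ⟩
  R + Q      ∎)
  where open ≤-Reasoning

add-≤ : ∀ {a b c d} → a ≤ b → c ≤ d → a + c ≤ b + d
add-≤ = +-mono-≤

scale-≤ : ∀ n {a b} → a ≤ b → n * a ≤ n * b
scale-≤ n = *-monoʳ-≤ n

-- The case split of the Ordering is on the sign of D = s − p.  The term d is the
-- part of the loss at the last site below (scaled by 3) that is not yet paid back.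
DeficitBound : ∀ {s p} → Ordering s p → ℕ → ℕ → ℕ → Set
DeficitBound (less s k)    d X Y = Y ≤ X + 2
DeficitBound (equal s)     d X Y = Y ≤ X
DeficitBound (greater p k) d X Y = Y + d ≤ X + 4 * suc k

-- `p` stands for `1 + 2 * p′`. It is kept as a variable so that the `Ordering` can be matched; the
-- two halves of |s - 2s′| ≤ r carry the equation in their added terms.
site-step : ∀ {s p s′ p′} (o : Ordering s p) (o′ : Ordering s′ p′) r X Y →
  s + (1 + 2 * p′) ≤ 2 * s′ + r + p → 2 * s′ + p ≤ s + r + (1 + 2 * p′) →
  DeficitBound o′ 4 X Y → DeficitBound o 0 (3 * r + X + p) (3 * 1 + Y + s)
site-step (less s k) (less s′ k′) r X Y u v ih =
  ≤-certificate (2 * k′ + 2 * r) (add-≤ ih u) (solve (s ∷ k ∷ s′ ∷ k′ ∷ r ∷ X ∷ Y ∷ []))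
site-step (less s k) (equal s′) r X Y u v ih =
  ≤-certificate (2 * r) (add-≤ ih u) (solve (s ∷ k ∷ s′ ∷ r ∷ X ∷ Y ∷ []))
-- Doubling `v` eliminates the term `4 * suc k′` of the induction hypothesis.
site-step (less s k) (greater p′ k′) r X Y u v ih =
  ≤-certificate (3 * k + 4 + r) (add-≤ ih (scale-≤ 2 v)) (solve (s ∷ k ∷ p′ ∷ k′ ∷ r ∷ X ∷ Y ∷ []))
site-step (equal s) (less s′ k′) r X Y u v ih =
  ≤-certificate (1 + 4 * k′ + r) (add-≤ ih (scale-≤ 2 u)) (solve (s ∷ s′ ∷ k′ ∷ r ∷ X ∷ Y ∷ []))
-- Agreement on both levels of a site forces `1 ≤ r`, and the weight 3 of that cut edge pays for the
-- site.
site-step (equal s) (equal s′) r X Y u v ih =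
  ≤-certificate 0 (add-≤ ih (scale-≤ 3 u)) (solve (s ∷ s′ ∷ r ∷ X ∷ Y ∷ []))
-- This case needs the whole 4: at `k′ = 0` the certificate has no slack.
site-step (equal s) (greater p′ k′) r X Y u v ih =
  ≤-certificate (2 * k′) (add-≤ ih (scale-≤ 3 v)) (solve (s ∷ p′ ∷ k′ ∷ r ∷ X ∷ Y ∷ []))
site-step (greater p k) (less s′ k′) r X Y u v ih =
  ≤-certificate (2 + 4 * k + 2 * k′ + 2 * r) (add-≤ ih u) (solve (p ∷ k ∷ s′ ∷ k′ ∷ r ∷ X ∷ Y ∷ []))
site-step (greater p k) (equal s′) r X Y u v ih =
  ≤-certificate (3 * k + 3 * r) ih (solve (p ∷ k ∷ s′ ∷ r ∷ X ∷ Y ∷ []))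
site-step (greater p k) (greater p′ k′) r X Y u v ih =
  ≤-certificate (k + r) (add-≤ ih (scale-≤ 2 v)) (solve (p ∷ k ∷ p′ ∷ k′ ∷ r ∷ X ∷ Y ∷ []))

gap-step : ∀ {s p s′ p′} (o : Ordering s p) (o′ : Ordering s′ p′) d r X Y → d ≤ 2 →
  s + 2 * p′ ≤ 2 * s′ + r + p → 2 * s′ + p ≤ s + r + 2 * p′ →
  DeficitBound o′ d X Y → DeficitBound o (2 + d) (3 * r + X + p) (Y + s)
gap-step (less s k) (less s′ k′) d r X Y d≤2 u v ih =
  ≤-certificate (1 + k + 3 * r) ih (solve (s ∷ k ∷ s′ ∷ k′ ∷ r ∷ X ∷ Y ∷ []))
gap-step (less s k) (equal s′) d r X Y d≤2 u v ih =
  ≤-certificate (3 + k + 3 * r) ih (solve (s ∷ k ∷ s′ ∷ r ∷ X ∷ Y ∷ []))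
gap-step (less s k) (greater p′ k′) d r X Y d≤2 u v ih =
  ≤-certificate (3 * k + 5 + d + r) (add-≤ ih (scale-≤ 2 v)) (solve (s ∷ k ∷ p′ ∷ k′ ∷ d ∷ r ∷ X ∷ Y ∷ []))
gap-step (equal s) (less s′ k′) d r X Y d≤2 u v ih =
  ≤-certificate (2 * k′ + 2 * r) (add-≤ ih u) (solve (s ∷ s′ ∷ k′ ∷ r ∷ X ∷ Y ∷ []))
gap-step (equal s) (equal s′) d r X Y d≤2 u v ih =
  ≤-certificate (3 * r) ih (solve (s ∷ s′ ∷ r ∷ X ∷ Y ∷ []))
gap-step (equal s) (greater p′ k′) d r X Y d≤2 u v ih =
  ≤-certificate (d + r) (add-≤ ih (scale-≤ 2 v)) (solve (s ∷ p′ ∷ k′ ∷ d ∷ r ∷ X ∷ Y ∷ []))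
-- Here and in the next case the bound for the level above contains no `d`; the term `4 * suc k` and
-- the cut edges of this level cover `2 + d` because `d ≤ 2`.
gap-step (greater p k) (less s′ k′) d r X Y d≤2 u v ih =
  ≤-certificate (4 * k + 2 * k′ + 2 * r) (add-≤ (add-≤ ih d≤2) u) (solve (p ∷ k ∷ s′ ∷ k′ ∷ d ∷ r ∷ X ∷ Y ∷ []))
gap-step (greater p k) (equal s′) d r X Y d≤2 u v ih =
  ≤-certificate (4 * k + 2 * r) (add-≤ (add-≤ ih d≤2) u) (solve (p ∷ k ∷ s′ ∷ d ∷ r ∷ X ∷ Y ∷ []))
gap-step (greater p k) (greater p′ k′) d r X Y d≤2 u v ih =
  ≤-certificate (2 * k′) (add-≤ ih (scale-≤ 3 v)) (solve (p ∷ k ∷ p′ ∷ k′ ∷ d ∷ r ∷ X ∷ Y ∷ []))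

-- The potential for multiplier 1: a surplus is free, and a deficit may cost twice its size.
SurplusBound : ∀ {s p} → Ordering s p → ℕ → ℕ → Set
SurplusBound (less s k)    X Y = Y ≤ X + 2 * suc k
SurplusBound (equal s)     X Y = Y ≤ X
SurplusBound (greater p k) X Y = Y ≤ X

-- `c` is 1 at a site and 0 at a gap, so both kinds of level are treated at once. If both levels
-- have a surplus, a single extra vertex of the lower one already pays for the site.
surplus-step : ∀ {s p s′ p′} (o : Ordering s p) (o′ : Ordering s′ p′) c r X Y → c ≤ 1 →
  s + (c + 2 * p′) ≤ 2 * s′ + r + p → 2 * s′ + p ≤ s + r + (c + 2 * p′) →
  SurplusBound o′ X Y → SurplusBound o (r + X + s) (c + Y + p)
surplus-step (less s k) (less s′ k′) c r X Y c≤1 u v ih =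
  ≤-certificate 0 (add-≤ ih u) (solve (s ∷ k ∷ s′ ∷ k′ ∷ c ∷ r ∷ X ∷ Y ∷ []))
surplus-step (less s k) (equal s′) c r X Y c≤1 u v ih =
  ≤-certificate 0 (add-≤ ih u) (solve (s ∷ k ∷ s′ ∷ c ∷ r ∷ X ∷ Y ∷ []))
surplus-step (less s k) (greater p′ k′) c r X Y c≤1 u v ih =
  ≤-certificate (k + r) (add-≤ ih c≤1) (solve (s ∷ k ∷ p′ ∷ k′ ∷ c ∷ r ∷ X ∷ Y ∷ []))
surplus-step (equal s) (less s′ k′) c r X Y c≤1 u v ih =
  ≤-certificate 0 (add-≤ ih u) (solve (s ∷ s′ ∷ k′ ∷ c ∷ r ∷ X ∷ Y ∷ []))
surplus-step (equal s) (equal s′) c r X Y c≤1 u v ih =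
  ≤-certificate 0 (add-≤ ih u) (solve (s ∷ s′ ∷ c ∷ r ∷ X ∷ Y ∷ []))
surplus-step (equal s) (greater p′ k′) c r X Y c≤1 u v ih =
  ≤-certificate (2 * k′) (add-≤ (add-≤ ih (scale-≤ 2 c≤1)) v) (solve (s ∷ p′ ∷ k′ ∷ c ∷ r ∷ X ∷ Y ∷ []))
surplus-step (greater p k) (less s′ k′) c r X Y c≤1 u v ih =
  ≤-certificate (2 + 2 * k) (add-≤ ih u) (solve (p ∷ k ∷ s′ ∷ k′ ∷ c ∷ r ∷ X ∷ Y ∷ []))
surplus-step (greater p k) (equal s′) c r X Y c≤1 u v ih =
  ≤-certificate (2 + 2 * k) (add-≤ ih u) (solve (p ∷ k ∷ s′ ∷ c ∷ r ∷ X ∷ Y ∷ []))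
surplus-step (greater p k) (greater p′ k′) c r X Y c≤1 u v ih =
  ≤-certificate (k + r) (add-≤ ih c≤1) (solve (p ∷ k ∷ p′ ∷ k′ ∷ c ∷ r ∷ X ∷ Y ∷ []))

gap-cost : ∀ r R p n → 3 * (r + R) + (2 * p + n) ≡ 3 * r + (3 * R + n) + 2 * p
gap-cost = solve-∀

site-cost : ∀ r R p n → 3 * (r + R) + (1 + 2 * p + n) ≡ 3 * r + (3 * R + n) + (1 + 2 * p)
site-cost = solve-∀

gap-gain : ∀ s N k → 3 * k + (s + N) ≡ 3 * k + N + s
gap-gain = solve-∀

site-gain : ∀ s N k → 3 * suc k + (s + N) ≡ 3 * 1 + (3 * k + N) + s
site-gain = solve-∀

surplus-cost : ∀ r R s N → r + R + (s + N) ≡ r + (R + N) + s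
surplus-cost = solve-∀

surplus-gain : ∀ k n p → k + (p + n) ≡ k + n + p
surplus-gain = solve-∀

thirds-left : ∀ R n → 3 * R + n + 2 ≡ 3 * R + 2 + n
thirds-left = solve-∀

thirds-right : ∀ R → suc (3 * R + 2) ≡ 3 * suc R
thirds-right = solve-∀

open import Data.Bool using (if_then_else_)
open import Data.List.Extrema.Nat using (max; xs≤max)
open import Data.List.Membership.Propositional using (_∈_; find; lose)
open import Data.List.Membership.Propositional.Properties
open import Data.List.Properties
  using (length-++; length-map; length-filter; length-upTo; filter-accept; filter-reject; filter-all; filter-none)
open import Data.List.Relation.Binary.Disjoint.Propositional using (Disjoint)
open import Data.List.Relation.Binary.Subset.Propositional using (_⊆_)
open import Data.List.Relation.Unary.All as Allˡ using ([]; _∷_) renaming (All to Allˡ)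
open import Data.List.Relation.Unary.All.Properties using (all-filter) renaming (map⁻ to All-map⁻; map⁺ to All-map⁺)
open import Data.List.Relation.Unary.AllPairs as AllPairs using ([]; _∷_)
open import Data.List.Relation.Unary.AllPairs.Properties using () renaming (map⁺ to AllPairs-map⁺)
open import Data.List.Relation.Unary.Any as Any using (here; there)
open import Data.List.Relation.Unary.Linked as Linkedˡ using ([]; [-]; _∷_) renaming (Linked to Linkedˡ)
open import Data.List.Relation.Unary.Linked.Properties using (Linked⇒AllPairs)
open import Data.List.Relation.Unary.Unique.Propositional using (Unique)
open import Data.List.Relation.Unary.Unique.Propositional.Properties
  using (filter⁺; concat⁺; upTo⁺) renaming (map⁺ to Unique-map⁺)
open import Data.Nat.ListAction using () renaming (sum to sumˡ)
open import Data.Nat.Logarithm using (⌈log₂_⌉; ⌈log₂⌉-mono-≤; ⌈log₂⌈n/2⌉⌉≡⌈log₂n⌉∸1; ⌈log₂2^n⌉≡n)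
open import Data.Product using (_,_; ∃-syntax; proj₂)
open import Data.Sum using (_⊎_; inj₁; inj₂; swap)
open import Data.Vec as Vec using (toList)
open import Data.Vec.Properties using (length-toList)
open import Data.Vec.Relation.Unary.All.Properties using (toList⁺)
open import Data.Vec.Relation.Unary.Linked using ([]; [-]; _∷_)
open import Function using (_∘_; _⇔_; Equivalence; mk⇔)
open import Relation.Binary using (DecidableEquality; tri<; tri≈; tri>)
open import Relation.Binary.Construct.Closure.ReflexiveTransitive using (Star; ε; _◅_; _◅◅_; reverse)
open import Relation.Binary.PropositionalEquality
  using (_≢_; refl; sym; trans; cong; cong₂; subst; subst₂)
open import Relation.Nullary using (yes; no; ¬_; does; contradiction)
open import Relation.Nullary.Decidable using (map′; _×-dec_; dec-true; dec-false)
open import Relation.Unary using (∁)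

open import Algebra.Properties.CommutativeSemigroup +-commutativeSemigroup using (interchange)

open V using (level; index)

-- Summing the level inequalities along a profile

-- Profile e A k p n describes A consecutive levels with k sites, at least e levels
-- below the first site, p vertices on the lowest level and n vertices in total.
data Profile : (e A k p n : ℕ) → Set where
  empty : ∀ {e} → Profile e 0 0 0 0
  gap   : ∀ {e A k p n} → e ≤ 1 → Profile e A k p n →
          Profile (suc e) (suc A) k (2 * p) (2 * p + n)
  site  : ∀ {A k p n} → Profile 2 A k p n →
          Profile 0 (suc A) (suc k) (1 + 2 * p) (1 + 2 * p + n)
  relax : ∀ {A k p n} → Profile 1 A k p n → Profile 0 A k p n

DeficitBound-weaken : ∀ {s p} (o : Ordering s p) {d X Y} → DeficitBound o d X Y → DeficitBound o 0 X Y
DeficitBound-weaken (less _ _)    h = h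
DeficitBound-weaken (equal _)     h = h
DeficitBound-weaken (greater _ _) {d} {X} {Y} h = ≤-trans (+-monoʳ-≤ Y z≤n) h

-- The lowest level selects the potential. A deficit there leaves an error of 2 against a factor of
-- 3, which rounding removes; in the other two cases the surplus bound is exact.
sites≤weight : ∀ {s p k n} (o : Ordering s p) R →
  DeficitBound o 0 (3 * R + n) (3 * k + n) → SurplusBound o (R + n) (k + n) → k ≤ R
sites≤weight {k = k} {n} (less _ _) R h _ = s≤s⁻¹ (*-cancelˡ-< 3 k (suc R) (begin-strict
  3 * k            ≤⟨ +-cancelʳ-≤ n (3 * k) (3 * R + 2) (≤-trans h (≤-reflexive (thirds-left R n))) ⟩
  3 * R + 2        <⟨ n<1+n _ ⟩
  suc (3 * R + 2)  ≡⟨ thirds-right R ⟩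
  3 * suc R        ∎))
  where open ≤-Reasoning
sites≤weight (equal _)     R _ h = +-cancelʳ-≤ _ _ R h
sites≤weight (greater _ _) R _ h = +-cancelʳ-≤ _ _ R h

module _ {s r N R : ℕ → ℕ}
  (N-suc : ∀ a → N a ≡ s a + N (suc a))
  (R-suc : ∀ a → R a ≡ r a + R (suc a))
  (s-rise : ∀ a → s a ≤ 2 * s (suc a) + r a)
  (s-fall : ∀ a → 2 * s (suc a) ≤ s a + r a)
  where

  private
    up : ∀ a p → s a + p ≤ 2 * s (suc a) + r a + p
    up a p = +-monoˡ-≤ p (s-rise a)

    down : ∀ a p → 2 * s (suc a) + p ≤ s a + r a + p
    down a p = +-monoˡ-≤ p (s-fall a)

    s-top : ∀ a → N a ≡ 0 → s a ≡ 0
    s-top a N≡0 = m+n≡0⇒m≡0 (s a) (trans (sym (N-suc a)) N≡0)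

  -- Induction from the top level down to `a`, where `N (A + a) ≡ 0` makes `s` vanish from `A + a`
  -- on. Each of the `e` levels guaranteed below the next site contributes 2, whence `2 * e`.
  deficit-bound : ∀ {e A k p n} → Profile e A k p n → ∀ a → N (A + a) ≡ 0 →
    DeficitBound (compare (s a) p) (2 * e) (3 * R a + n) (3 * k + N a)
  -- `compare 0 0` reduces to `equal 0` and the left side to 0, so cut edges still counted by `R a`
  -- do no harm.
  deficit-bound empty a N≡0 rewrite s-top a N≡0 | N≡0 = z≤n
  deficit-bound {suc e} {suc A} {k} (gap {p = p} {n} e≤1 P) a N≡0
    rewrite R-suc a | N-suc a
          | gap-cost (r a) (R (suc a)) p n | gap-gain (s a) (N (suc a)) k | *-suc 2 e
    = gap-step (compare (s a) (2 * p)) (compare (s (suc a)) p) (2 * e) (r a) _ _ (*-monoʳ-≤ 2 e≤1)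
        (up a (2 * p)) (down a (2 * p))
        (deficit-bound P (suc a) (trans (cong N (+-suc A a)) N≡0))
  deficit-bound {A = suc A} (site {k = k} {p = p} {n} P) a N≡0
    rewrite R-suc a | N-suc a
          | site-cost (r a) (R (suc a)) p n | site-gain (s a) (N (suc a)) k
    = site-step (compare (s a) (1 + 2 * p)) (compare (s (suc a)) p) (r a) _ _
        (up a (1 + 2 * p)) (down a (1 + 2 * p))
        (deficit-bound P (suc a) (trans (cong N (+-suc A a)) N≡0))
  deficit-bound (relax P) a N≡0 = DeficitBound-weaken (compare (s a) _) (deficit-bound P a N≡0)

  surplus-bound : ∀ {e A k p n} → Profile e A k p n → ∀ a → N (A + a) ≡ 0 →
    SurplusBound (compare (s a) p) (R a + N a) (k + n)
  surplus-bound empty a N≡0 rewrite s-top a N≡0 = z≤n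
  surplus-bound {A = suc A} (gap {k = k} {p = p} {n} _ P) a N≡0
    rewrite R-suc a | N-suc a
          | surplus-cost (r a) (R (suc a)) (s a) (N (suc a)) | surplus-gain k n (2 * p)
    = surplus-step (compare (s a) (2 * p)) (compare (s (suc a)) p) 0 (r a) _ _ z≤n
        (up a (2 * p)) (down a (2 * p))
        (surplus-bound P (suc a) (trans (cong N (+-suc A a)) N≡0))
  surplus-bound {A = suc A} (site {k = k} {p = p} {n} P) a N≡0
    rewrite R-suc a | N-suc a
          | surplus-cost (r a) (R (suc a)) (s a) (N (suc a)) | surplus-gain k n (1 + 2 * p)
    = surplus-step (compare (s a) (1 + 2 * p)) (compare (s (suc a)) p) 1 (r a) _ _ (s≤s z≤n)
        (up a (1 + 2 * p)) (down a (1 + 2 * p))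
        (surplus-bound P (suc a) (trans (cong N (+-suc A a)) N≡0))
  surplus-bound (relax P) a N≡0 = surplus-bound P a N≡0

  sites≤cut : ∀ {A k p n} → Profile 0 A k p n → N A ≡ 0 → N 0 ≡ n → k ≤ R 0
  sites≤cut {A} {p = p} P NA≡0 N0≡n = sites≤weight (compare (s 0) p) (R 0)
    (subst (DeficitBound (compare (s 0) p) 0 (3 * R 0 + _)) (cong (_ +_) N0≡n) (deficit-bound P 0 N≡0))
    (subst (λ x → SurplusBound (compare (s 0) p) (R 0 + x) _) N0≡n (surplus-bound P 0 N≡0))
    where
    N≡0 : N (A + 0) ≡ 0
    N≡0 = trans (cong N (+-identityʳ A)) NA≡0

-- Level counts of full subtrees with gapped heights

-- A full subtree of height `i > a` has this many vertices on level a + 1. Truncated subtraction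
-- would count 1 for `i ≤ a`, so such entries have to be dropped before `a` is reached.
population : ℕ → List ℕ → ℕ
population a is = sumˡ (mapˡ (λ i → 2 ^ (i ∸ suc a)) is)

total : ℕ → List ℕ → ℕ
total a is = sumˡ (mapˡ (λ i → ν (i ∸ a)) is)

ν-suc : ∀ d → ν (suc d) ≡ 2 ^ d + ν d
ν-suc d = trans (cong (λ x → 2 ^ d + x ∸ 1) (+-identityʳ (2 ^ d))) (+-∸-assoc (2 ^ d) (m^n>0 2 d))

m∸n≡1+[m∸[1+n]] : ∀ {a i} → a < i → i ∸ a ≡ suc (i ∸ suc a)
m∸n≡1+[m∸[1+n]] {a} {i} a<i =
  trans (cong (_∸ a) (sym (m+[n∸m]≡n a<i))) (trans (cong (_∸ a) (sym (+-suc a _))) (m+n∸m≡n a _))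

total-suc : ∀ {a is} → Allˡ (a <_) is → total a is ≡ population a is + total (suc a) is
total-suc [] = refl
total-suc {a} {i ∷ is} (a<i ∷ h)
  rewrite total-suc h | m∸n≡1+[m∸[1+n]] a<i | ν-suc (i ∸ suc a)
  = interchange (2 ^ (i ∸ suc a)) (ν (i ∸ suc a)) (population a is) (total (suc a) is)

population-suc : ∀ {a is} → Allˡ (suc a <_) is → population a is ≡ 2 * population (suc a) is
population-suc [] = refl
population-suc {a} {i ∷ is} (a<i ∷ h)
  rewrite population-suc h | m∸n≡1+[m∸[1+n]] a<i = sym (*-distribˡ-+ 2 (2 ^ (i ∸ suc (suc a))) (population (suc a) is))

Gapped : List ℕ → Set
Gapped = Linkedˡ (λ a b → a + 3 ≤ b)

tail-above : ∀ {i is} → Gapped (i ∷ is) → Allˡ (i + 3 ≤_) is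
tail-above h with Linked⇒AllPairs {R = λ a b → a + 3 ≤ b} (λ {_} {b} p q → ≤-trans p (≤-trans (m≤m+n b 3) q)) h
... | above ∷ _ = above

profile-gap : ∀ {e A a is} → e ≤ 1 → Allˡ (suc a <_) is →
  Profile e A (length is) (population (suc a) is) (total (suc a) is) →
  Profile (suc e) (suc A) (length is) (population a is) (total a is)
profile-gap {e} {A} {a} {is} e≤1 above P
  rewrite total-suc (Allˡ.map <⇒≤ above) | population-suc above = gap e≤1 P

-- Recursion on the number of levels left. `is` holds only the heights above `a`, and its head is
-- removed when the recursion meets its level.
profile : ∀ A a e is → e ≤ 2 → Allˡ (e + a <_) is → Allˡ (_≤ A + a) is → Gapped is →
  Profile e A (length is) (population a is) (total a is)
profile zero a e [] _ _ _ _ = empty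
profile zero a e (i ∷ is) _ (e+a<i ∷ _) (i≤a ∷ _) _ =
  contradiction (≤-trans i≤a (m≤n+m a e)) (<⇒≱ e+a<i)
profile (suc A) a (suc e) is (s≤s e≤1) above below g =
  profile-gap e≤1 (Allˡ.map (≤-trans (s≤s (s≤s (m≤n+m a e)))) above)
    (profile A (suc a) e is (m≤n⇒m≤1+n e≤1)
      (subst (λ x → Allˡ (x <_) is) (sym (+-suc e a)) above)
      (subst (λ x → Allˡ (_≤ x) is) (sym (+-suc A a)) below) g)
profile (suc A) a zero [] _ _ _ _ =
  relax (profile-gap {0} {a = a} {[]} z≤n [] (profile A (suc a) 0 [] z≤n [] [] []))
profile (suc A) a zero (i ∷ is) _ (a<i ∷ above) (i≤ ∷ below) g with m≤n⇒m<n∨m≡n a<i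
... | inj₁ a+1<i = relax (profile-gap z≤n above′
        (profile A (suc a) 0 (i ∷ is) z≤n above′
          (subst (λ x → Allˡ (_≤ x) (i ∷ is)) (sym (+-suc A a)) (i≤ ∷ below)) g))
  where
  above′ : Allˡ (suc a <_) (i ∷ is)
  above′ = a+1<i ∷ Allˡ.map (≤-trans (≤-trans a+1<i (m≤m+n i 3))) (tail-above g)
-- The site is on level a + 1 and the next one on level a + 4 or higher, so levels a + 2 and a + 3
-- are the two free levels that `site` demands.
... | inj₂ refl = at-site (profile A (suc a) 2 is ≤-refl above₄
        (subst (λ x → Allˡ (_≤ x) is) (sym (+-suc A a)) below) (Linkedˡ.tail g))
  where
  above₄ : Allˡ (3 + a <_) is
  above₄ = Allˡ.map (≤-trans (≤-reflexive (cong suc (+-comm 3 a)))) (tail-above g)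

  at-site : Profile 2 A (length is) (population (suc a) is) (total (suc a) is) →
    Profile 0 (suc A) (suc (length is)) (2 ^ (a ∸ a) + population a is) (ν (suc a ∸ a) + total a is)
  at-site P
    rewrite total-suc above | population-suc (Allˡ.map (≤-trans (s≤s (m≤n+m (suc a) 2))) above₄)
          | +-∸-assoc 1 (≤-refl {a}) | n∸n≡0 a
    = site P

-- Counting in lists, level by level

module _ {B : Set} where

  -- Deleting one occurrence of the head from `ys` keeps all members of the tail, since they differ
  -- from the head.
  Unique-⊆⇒length-≤ : {xs ys : List B} → Unique xs → xs ⊆ ys → length xs ≤ length ys
  Unique-⊆⇒length-≤ [] _ = z≤n
  Unique-⊆⇒length-≤ {x ∷ xs} (x∉xs ∷ uniq) xs⊆ys
    with as , bs , refl ← ∈-∃++ (xs⊆ys (here refl)) = begin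
      suc (length xs)               ≤⟨ s≤s (Unique-⊆⇒length-≤ uniq xs⊆) ⟩
      suc (length (as ++ bs))       ≡⟨ cong suc (length-++ as) ⟩
      suc (length as + length bs)   ≡⟨ +-suc _ _ ⟨
      length as + length (x ∷ bs)   ≡⟨ length-++ as ⟨
      length (as ++ x ∷ bs)         ∎
    where
    open ≤-Reasoning
    xs⊆ : xs ⊆ as ++ bs
    xs⊆ y∈xs with ∈-++⁻ as (xs⊆ys (there y∈xs))
    ... | inj₁ y∈as         = ∈-++⁺ˡ y∈as
    ... | inj₂ (here refl)  = contradiction refl (Allˡ.lookup x∉xs y∈xs)
    ... | inj₂ (there y∈bs) = ∈-++⁺ʳ as y∈bs

  layer above : (B → ℕ) → ℕ → List B → List B
  layer f a = filter (λ x → f x ≟ a)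
  above f a = filter (λ x → a ≤? f x)

  length-above : ∀ f a xs →
    length (above f a xs) ≡ length (layer f a xs) + length (above f (suc a) xs)
  length-above f a [] = refl
  length-above f a (x ∷ xs) with <-cmp (f x) a
  ... | tri< fx<a fx≢a _
    rewrite filter-reject (λ x → a ≤? f x) {x} {xs} (<⇒≱ fx<a)
          | filter-reject (λ x → f x ≟ a) {x} {xs} fx≢a
          | filter-reject (λ x → suc a ≤? f x) {x} {xs} (<⇒≱ (m≤n⇒m≤1+n fx<a))
    = length-above f a xs
  ... | tri≈ _ refl _
    rewrite filter-accept (λ y → f x ≤? f y) {x} {xs} ≤-refl
          | filter-accept (λ y → f y ≟ f x) {x} {xs} refl
          | filter-reject (λ y → suc (f x) ≤? f y) {x} {xs} (<⇒≱ ≤-refl)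
    = cong suc (length-above f (f x) xs)
  ... | tri> _ fx≢a a<fx
    rewrite filter-accept (λ x → a ≤? f x) {x} {xs} (<⇒≤ a<fx)
          | filter-reject (λ x → f x ≟ a) {x} {xs} fx≢a
          | filter-accept (λ x → suc a ≤? f x) {x} {xs} a<fx
    = trans (cong suc (length-above f a xs)) (sym (+-suc _ _))

  above-none : ∀ f a xs → Allˡ (λ x → f x < a) xs → length (above f a xs) ≡ 0
  above-none f a xs h = cong length (filter-none (λ x → a ≤? f x) (Allˡ.map <⇒≱ h))

-- Parents and children in the tree

infix 4 _≟ᵥ_

_≟ᵥ_ : DecidableEquality V
vertex i j ≟ᵥ vertex i′ j′ = map′ (λ { (refl , refl) → refl }) (λ { refl → refl , refl }) (i ≟ i′ ×-dec j ≟ j′)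

open import Data.List.Membership.DecPropositional _≟ᵥ_ using (_∈?_)

children : V → List V
children (vertex zero          j) = []
children (vertex (suc zero)    j) = []
children (vertex (suc (suc i)) j) = vertex (suc i) (j + j) ∷ vertex (suc i) (suc (j + j)) ∷ []

parent-child : ∀ v {w} → w ∈ children v → parent w ≡ v
parent-child (vertex (suc (suc i)) j) (here refl)         = cong (λ x → vertex (2 + i) x) (sym (n≡⌊n+n/2⌋ j))
parent-child (vertex (suc (suc i)) j) (there (here refl)) = cong (λ x → vertex (2 + i) x) (sym (n≡⌈n+n/2⌉ j))

halves : ∀ j → j ≡ ⌊ j /2⌋ + ⌊ j /2⌋ ⊎ j ≡ suc (⌊ j /2⌋ + ⌊ j /2⌋)
halves zero          = inj₁ refl
halves (suc zero)    = inj₂ refl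
halves (suc (suc j)) with halves j
... | inj₁ eq = inj₁ (cong suc (trans (cong suc eq) (sym (+-suc _ _))))
... | inj₂ eq = inj₂ (cong suc (trans (cong suc eq) (cong suc (sym (+-suc _ _)))))

child-parent : ∀ v → v ∈ children (parent v)
child-parent (vertex (suc i) j) with halves j
... | inj₁ eq = here (cong (λ x → vertex (suc i) x) eq)
... | inj₂ eq = there (here (cong (λ x → vertex (suc i) x) eq))

children-unique : ∀ v → Unique (children v)
children-unique (vertex zero          j) = []
children-unique (vertex (suc zero)    j) = []
children-unique (vertex (suc (suc i)) j) =
  ((λ eq → m≢1+m+n (j + j) (trans (cong index eq) (cong suc (sym (+-identityʳ _))))) ∷ []) ∷ [] ∷ []

-- Levels counted from 0, to match the indexing of the level counts: height `a` is level a + 1.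
height : V → ℕ
height v = pred (level v)

height-parent : ∀ v → height (parent v) ≡ suc (height v)
height-parent (vertex (suc i) j) = refl

length-children : ∀ a vs → Allˡ (λ v → height v ≡ suc a) vs →
  length (concatMap children vs) ≡ 2 * length vs
length-children a [] [] = refl
length-children a (vertex (suc (suc i)) j ∷ vs) (_ ∷ h) =
  trans (cong (2 +_) (length-children a vs h)) (sym (*-suc 2 (length vs)))

concatMap-children-unique : ∀ {vs} → Unique vs → Unique (concatMap children vs)
concatMap-children-unique {vs} uniq = concat⁺
  (All-map⁺ (Allˡ.universal children-unique vs))
  (AllPairs-map⁺ (AllPairs.map disjoint uniq))
  where
  disjoint : ∀ {u v} → u ≢ v → Disjoint (children u) (children v)
  disjoint u≢v (w∈u , w∈v) = u≢v (trans (sym (parent-child _ w∈u)) (parent-child _ w∈v))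

-- A cut edge may point up or down. Attributing it to its lower end assigns it to exactly one pair
-- of consecutive levels.
low : V × V → V
low (u , v) = if does (level u <? level v) then u else v

low-up : ∀ v → low (v , parent v) ≡ v
low-up v rewrite dec-true (level v <? suc (level v)) ≤-refl = refl

low-down : ∀ v → low (parent v , v) ≡ v
low-down v rewrite dec-false (suc (level v) <? level v) (<⇒≯ ≤-refl) = refl

-- The lower bound for an arbitrary finite set

module _ {S : VertexSet} {xs : List V} (uniq : Unique xs) (mem : ∀ x → x ∈ xs ⇔ S x)
         {es : List (V × V)} (edges : ∀ e → e ∈ es ⇔ Cut S e) where

  private
    s r : ℕ → ℕ
    s a = length (layer height a xs)
    r a = length (layer (height ∘ low) a es)

    lows : ℕ → List V
    lows a = mapˡ low (layer (height ∘ low) a es)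

    ∈-lows : ∀ {a v} e → Cut S e → low e ≡ v → height v ≡ a → v ∈ lows a
    ∈-lows e cut refl h = ∈-map⁺ low (∈-filter⁺ _ (Equivalence.from (edges e) cut) h)

    -- If the parent of a vertex of S lies outside S, the edge between them is in the cut and the
    -- vertex is its lower end.
    layer-⊆ : ∀ a → layer height a xs ⊆ concatMap children (layer height (suc a) xs) ++ lows a
    layer-⊆ a {v} v∈ with v∈xs , h ← ∈-filter⁻ (λ x → height x ≟ a) v∈ | parent v ∈? xs
    ... | yes pv∈xs = ∈-++⁺ˡ (∈-concatMap⁺ children (Any.map (λ { refl → child-parent v })
            (∈-filter⁺ (λ x → height x ≟ suc a) pv∈xs (trans (height-parent v) (cong suc h)))))
    ... | no  pv∉xs = ∈-++⁺ʳ _ (∈-lows (v , parent v)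
            (Equivalence.to (mem v) v∈xs , pv∉xs ∘ Equivalence.from (mem _) , inj₁ refl) (low-up v) h)

    -- The mirror image: a child outside S of a vertex of S is the lower end of a cut edge. The two
    -- inclusions give |s a - 2 s (a + 1)| ≤ r a.
    children-⊆ : ∀ a → concatMap children (layer height (suc a) xs) ⊆ layer height a xs ++ lows a
    children-⊆ a {w} w∈
      with u , u∈ , w∈u ← find (∈-concatMap⁻ children {xs = layer height (suc a) xs} w∈)
      with refl ← parent-child u w∈u
      with u∈xs , h ← ∈-filter⁻ (λ x → height x ≟ suc a) {xs = xs} u∈
      | w ∈? xs
    ... | yes w∈xs = ∈-++⁺ˡ (∈-filter⁺ _ w∈xs (suc-injective (trans (sym (height-parent w)) h)))
    ... | no  w∉xs = ∈-++⁺ʳ (layer height a xs) (∈-lows (parent w , w)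
            (Equivalence.to (mem _) u∈xs , w∉xs ∘ Equivalence.from (mem _) , inj₂ refl)
            (low-down w) (suc-injective (trans (sym (height-parent w)) h)))

    length-lows : ∀ a (vs : List V) → length (vs ++ lows a) ≡ length vs + r a
    length-lows a vs = trans (length-++ vs)
      (cong (length vs +_) (length-map low (layer (height ∘ low) a es)))

    length-next : ∀ a → length (concatMap children (layer height (suc a) xs)) ≡ 2 * s (suc a)
    length-next a = length-children a _ (all-filter (λ x → height x ≟ suc a) xs)

    s-rise : ∀ a → s a ≤ 2 * s (suc a) + r a
    s-rise a = ≤-trans (Unique-⊆⇒length-≤ (filter⁺ _ uniq) (layer-⊆ a))
      (≤-reflexive (trans (length-lows a (concatMap children (layer height (suc a) xs)))
        (cong (_+ r a) (length-next a))))

    s-fall : ∀ a → 2 * s (suc a) ≤ s a + r a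
    s-fall a = subst₂ _≤_ (length-next a) (length-lows a (layer height a xs))
      (Unique-⊆⇒length-≤ (concatMap-children-unique (filter⁺ _ uniq)) (children-⊆ a))

  cut-lower-bound : ∀ is → Allˡ (1 ≤_) is → Gapped is → length xs ≡ total 0 is →
    length is ≤ length es
  cut-lower-bound is pos gaps size = ≤-trans
    (sites≤cut (λ a → length-above height a xs) (λ a → length-above (height ∘ low) a es)
      s-rise s-fall
      (profile A 0 0 is z≤n pos is≤A gaps)
      (above-none height A xs heights<A)
      (trans (cong length (filter-all (λ x → 0 ≤? height x) (Allˡ.universal (λ _ → z≤n) xs))) size))
    (length-filter _ es)
    where
    mi = max 0 is
    mh = max 0 (mapˡ height xs)
    -- High enough to include every site and to lie strictly above every vertex of S.
    A = mi + suc mh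

    is≤A : Allˡ (_≤ A + 0) is
    is≤A = Allˡ.map (λ i≤ → ≤-trans i≤ (≤-trans (m≤m+n mi (suc mh)) (m≤m+n A 0))) (xs≤max 0 is)

    heights<A : Allˡ (λ v → height v < A) xs
    heights<A = Allˡ.map (λ h → ≤-trans (s≤s h) (m≤n+m (suc mh) mi)) (All-map⁻ (xs≤max 0 (mapˡ height xs)))

-- Binary length and the extremal forest

-- The number of binary digits of j.
bits : ℕ → ℕ
bits j = ⌈log₂ suc j ⌉

bits-positive : ∀ j → 1 ≤ bits (suc j)
bits-positive j = ≤-trans (≤-reflexive (sym (⌈log₂2^n⌉≡n 1))) (⌈log₂⌉-mono-≤ {2} {2 + j} (s≤s (s≤s z≤n)))

-- The rounded-up half of `suc j` reduces to `suc ⌊ j /2⌋`, so the logarithm law applies as it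
-- stands.
bits-half : ∀ j → bits ⌊ j /2⌋ ≡ bits j ∸ 1
bits-half j = ⌈log₂⌈n/2⌉⌉≡⌈log₂n⌉∸1 (suc j)

bits-suc : ∀ j → bits (suc j) ≡ suc (bits ⌊ suc j /2⌋)
bits-suc j = trans (sym (m+[n∸m]≡n (bits-positive j))) (cong suc (sym (bits-half (suc j))))

bits≤ : ∀ {i j} → j < 2 ^ i → bits j ≤ i
bits≤ {i} j< = subst (_ ≤_) (⌈log₂2^n⌉≡n i) (⌈log₂⌉-mono-≤ j<)

-- Halving removes one digit, and j < 2 (⌊j/2⌋ + 1).
bits≤⁻¹ : ∀ i j → bits j ≤ i → j < 2 ^ i
bits≤⁻¹ zero    zero    _ = s≤s z≤n
bits≤⁻¹ zero    (suc j) h = contradiction (≤-trans (bits-positive j) h) λ ()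
bits≤⁻¹ (suc i) j       h = ≤-trans j< (≤-trans (≤-reflexive (cong (λ x → suc h′ + x) (sym (+-identityʳ (suc h′)))))
  (*-monoʳ-≤ 2 (bits≤⁻¹ i ⌊ j /2⌋ (≤-trans (≤-reflexive (bits-half j)) (∸-monoˡ-≤ 1 h)))))
  where
  h′ = ⌊ j /2⌋
  j< : j < suc h′ + suc h′
  j< with halves j
  ... | inj₁ eq = s≤s (≤-trans (≤-reflexive eq) (+-monoʳ-≤ h′ (n≤1+n h′)))
  ... | inj₂ eq = s≤s (≤-reflexive (trans eq (sym (+-suc h′ h′))))

suc-ν : ∀ i → suc (ν i) ≡ 2 ^ i
suc-ν i = m+[n∸m]≡n (m^n>0 2 i)

-- The full subtree with root (i , 1): its vertices on level l are those whose
-- index has i + 1 − l binary digits.  Subtrees with different i are disjoint, and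
-- the parent (i + 1 , 0) of the root lies in none of them.
InTree : ℕ → V → Set
InTree i v = 1 ≤ index v × level v + bits (index v) ≡ suc i

-- A vertex of the subtree is determined by its index, which runs through 1, …, ν i.
node : ℕ → ℕ → V
node i j = vertex (suc (i ∸ bits (suc j))) (suc j)

tree : ℕ → List V
tree i = mapˡ (node i) (upTo (ν i))

∈-tree⁺ : ∀ {i v} → InTree i v → v ∈ tree i
∈-tree⁺ {i} {vertex (suc l) (suc j)} (_ , eq) =
  subst (_∈ tree i) (cong (λ l → vertex (suc l) (suc j)) (trans (cong (_∸ bits (suc j)) (sym eq′)) (m+n∸n≡m l (bits (suc j)))))
    (∈-map⁺ (node i) (∈-upTo⁺ (s<s⁻¹ (subst (suc j <_) (sym (suc-ν i))
      (bits≤⁻¹ i (suc j) (≤-trans (m≤n+m _ l) (≤-reflexive eq′)))))))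
  where
  eq′ : l + bits (suc j) ≡ i
  eq′ = suc-injective eq

∈-tree⁻ : ∀ {i v} → v ∈ tree i → InTree i v
∈-tree⁻ {i} v∈ with j , j∈ , refl ← ∈-map⁻ (node i) v∈ =
  s≤s z≤n , cong suc (m∸n+n≡m (bits≤ (subst (suc j <_) (suc-ν i) (s<s (∈-upTo⁻ j∈)))))

-- The parent is one level higher and its index one digit shorter, so the sum is invariant;
-- `2 ≤ index v` keeps the new index positive.
InTree-parent⁺ : ∀ {i} v → 2 ≤ index v → InTree i v → InTree i (parent v)
InTree-parent⁺ (vertex l 1) (s≤s ())
InTree-parent⁺ (vertex l (suc (suc j))) _ (_ , eq) =
  s≤s z≤n , trans (trans (sym (+-suc l _)) (cong (l +_) (sym (bits-suc (suc j))))) eq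

InTree-parent⁻ : ∀ {i} v → InTree i (parent v) → InTree i v
InTree-parent⁻ (vertex l (suc (suc j))) (_ , eq) =
  s≤s z≤n , trans (trans (cong (l +_) (bits-suc (suc j))) (+-suc l _)) eq

Forest : List ℕ → VertexSet
Forest is v = ∃[ i ] i ∈ is × InTree i v

forest-size : ∀ {is} → Unique is → HasSize (Forest is) (total 0 is)
forest-size {is} uniq = concatMap tree is , unique , members , size is
  where
  disjoint : ∀ {i i′} → i ≢ i′ → Disjoint (tree i) (tree i′)
  disjoint i≢i′ (v∈i , v∈i′) =
    i≢i′ (suc-injective (trans (sym (proj₂ (∈-tree⁻ v∈i))) (proj₂ (∈-tree⁻ v∈i′))))

  unique : Unique (concatMap tree is)
  unique = concat⁺
    (All-map⁺ (Allˡ.universal (λ i → Unique-map⁺ (suc-injective ∘ cong index) (upTo⁺ (ν i))) is))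
    (AllPairs-map⁺ (AllPairs.map disjoint uniq))

  members : ∀ v → v ∈ concatMap tree is ⇔ Forest is v
  members v = mk⇔
    (λ v∈ → let i , i∈ , v∈i = find (∈-concatMap⁻ tree {xs = is} v∈) in i , i∈ , ∈-tree⁻ v∈i)
    (λ (i , i∈ , v∈i) → ∈-concatMap⁺ tree (lose i∈ (∈-tree⁺ v∈i)))

  size : ∀ is → length (concatMap tree is) ≡ total 0 is
  size []       = refl
  size (i ∷ is) = trans (length-++ (tree i))
    (cong₂ _+_ (trans (length-map (node i) (upTo (ν i))) (length-upTo (ν i))) (size is))

-- `suc (pred i)` is `i` for positive `i`, written so that the level is visibly nonzero.
rootEdge : ℕ → V × V
rootEdge i = vertex (suc (pred i)) 1 , vertex (suc i) 0

-- Children of tree vertices stay in the tree, and so do parents of vertices with index at least 2.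
-- Only the edges above the roots, which have index 1, are cut.
forest-cut : ∀ {is} → Unique is → Allˡ (1 ≤_) is → HasSize (Cut (Forest is)) (length is)
forest-cut {is} uniq pos = mapˡ rootEdge is , Unique-map⁺ (suc-injective ∘ cong (level ∘ proj₂)) uniq ,
  (λ e → mk⇔ (to {e}) (from {e})) , length-map rootEdge is
  where
  to : ∀ {e} → e ∈ mapˡ rootEdge is → Cut (Forest is) e
  to e∈ with ∈-map⁻ rootEdge e∈
  ... | i , i∈ , refl with s≤s {n = l} _ ← Allˡ.lookup pos i∈ =
    (suc l , i∈ , s≤s z≤n , trans (cong (suc l +_) (⌈log₂2^n⌉≡n 1)) (+-comm (suc l) 1)) ,
    (λ { (_ , _ , () , _) }) , inj₁ refl

  upward : ∀ u → Forest is u → ¬ Forest is (parent u) → (u , parent u) ∈ mapˡ rootEdge is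
  upward (vertex (suc l) 1) (i , i∈ , _ , eq) _
    with refl ← suc-injective (trans (sym eq) (trans (cong (suc l +_) (⌈log₂2^n⌉≡n 1)) (+-comm (suc l) 1)))
    = ∈-map⁺ rootEdge i∈
  upward u@(vertex _ (suc (suc j))) (i , i∈ , u∈) pu∉ =
    contradiction (i , i∈ , InTree-parent⁺ u (s≤s (s≤s z≤n)) u∈) pu∉

  from : ∀ {e} → Cut (Forest is) e → e ∈ mapˡ rootEdge is
  from {u , _} (u∈ , v∉ , inj₁ refl) = upward u u∈ v∉
  from {_ , v} ((i , i∈ , u∈) , v∉ , inj₂ refl) =
    contradiction (i , i∈ , InTree-parent⁻ v u∈) v∉

-- Connectedness of the complement

module _ {S : VertexSet} (up-closed : ∀ v → S (parent v) → S v) where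

  -- The complement is closed under parents, and halving lowers a positive index, so `t ≥ j` steps
  -- upward end at index 0. `t` is left free so that two such walks can be made to meet.
  path-to-spine : ∀ t l j → j ≤ t → ∁ S (vertex (suc l) j) →
    Star (InducedAdj (∁ S)) (vertex (suc l) j) (vertex (suc (t + l)) 0)
  path-to-spine zero    l .0 z≤n _ = ε
  path-to-spine (suc t) l j  j≤ v∉ =
    (v∉ , pv∉ , inj₁ refl) ◅
    subst (λ m → Star (InducedAdj (∁ S)) (vertex (2 + l) ⌊ j /2⌋) (vertex (suc m) 0)) (+-suc t l)
      (path-to-spine t (suc l) ⌊ j /2⌋ (half≤ j j≤) pv∉)
    where
    pv∉ : ∁ S (vertex (2 + l) ⌊ j /2⌋)
    pv∉ = v∉ ∘ up-closed (vertex (suc l) j)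

    half≤ : ∀ j → j ≤ suc t → ⌊ j /2⌋ ≤ t
    half≤ zero    _ = z≤n
    half≤ (suc j) h = s≤s⁻¹ (≤-trans (⌊n/2⌋<n j) h)

  complement-connected : InducesConnected (∁ S)
  complement-connected {vertex (suc l) j} {vertex (suc l′) j′} u∉ v∉ =
    -- The step counts are chosen so that both walks reach the spine on level 1 + l + l′ + j + j′.
    path-to-spine (l′ + (j + j′)) l j (≤-trans (m≤m+n j j′) (m≤n+m _ l′)) u∉ ◅◅
    subst (λ m → Star (InducedAdj (∁ S)) (vertex (suc m) 0) (vertex (suc l′) j′)) heights
      (reverse (λ (a , b , adj) → b , a , swap adj)
        (path-to-spine (l + (j + j′)) l′ j′ (≤-trans (m≤n+m j′ j) (m≤n+m _ l)) v∉))
    where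
    heights : l + (j + j′) + l′ ≡ l′ + (j + j′) + l
    heights = trans (+-comm _ l′) (trans (cong (l′ +_) (+-comm l _)) (sym (+-assoc l′ _ l)))

-- From vectors to lists, and the two minima

sum-ν : ∀ {k} (i : Vec ℕ k) → sum (map ν i) ≡ total 0 (toList i)
sum-ν Vec.[]      = refl
sum-ν (x Vec.∷ i) = cong (ν x +_) (sum-ν i)

toList-linked : ∀ {k} {i : Vec ℕ k} → Linked (λ a b → a + 3 ≤ b) i → Gapped (toList i)
toList-linked []      = []
toList-linked [-]     = [-]
toList-linked {i = _ Vec.∷ _ Vec.∷ _} (h ∷ g) = h ∷ toList-linked g

gapped-unique : ∀ {is} → Gapped is → Unique is
gapped-unique {[]}     _ = []
gapped-unique {i ∷ is} g =
  Allˡ.map (λ i+3≤ → <⇒≢ (≤-trans (m<m+n i (s≤s z≤n)) i+3≤)) (tail-above g) ∷ gapped-unique (Linkedˡ.tail g)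

theorem3p22 : ∀ (n k : ℕ) → 1 ≤ k → (i : Vec ℕ k) → All (1 ≤_) i →
    n ≡ sum (map ν i) → Linked (λ a b → a + 3 ≤ b) i →
    (δ[ n ]≡ k) × (δP[ n ]≡ k)
theorem3p22 n k _ i pos n≡ gaps =
  -- One forest attains both minima, and the bound `lower` holds for every S, with connected
  -- complement or not.
  ((F , size , cut) , λ m (_ , S-size , S-cut) → lower S-size S-cut) ,
  ((F , size , complement-connected closed , cut) , λ m (_ , S-size , _ , S-cut) → lower S-size S-cut)
  where
  is = toList i
  F = Forest is
  g = toList-linked gaps
  n≡total : n ≡ total 0 is
  n≡total = trans n≡ (sum-ν i)

  size : HasSize F n
  size = subst (HasSize F) (sym n≡total) (forest-size (gapped-unique g))

  cut : HasSize (Cut F) k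
  cut = subst (HasSize (Cut F)) (length-toList i) (forest-cut (gapped-unique g) (toList⁺ pos))

  closed : ∀ v → F (parent v) → F v
  closed v (i , i∈ , pv∈) = i , i∈ , InTree-parent⁻ v pv∈

  lower : ∀ {S m} → HasSize S n → HasSize (Cut S) m → k ≤ m
  lower (xs , uniq , mem , len) (es , _ , edges , len′) =
    subst₂ _≤_ (length-toList i) len′
      (cut-lower-bound uniq mem edges is (toList⁺ pos) g (trans len n≡total))
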